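{- Let $G$ be a bipartite graph on $n$ vertices. Then $G$ admits a $(2,n)$-differential coloring if and only if $G$ is not a complete bipartite graph.
   Context: Graphs are finite, simple and undirected. For an $n$-vertex graph $G=(V,E)$ and positive integers $d,k$, a $(d,kn)$-differential coloring of $G$ is an assignment of pairwise distinct numbers (colors) from $\{1,\dots,kn\}$ to the vertices of $G$, i.e. an injective map $c:V\to\{1,\dots,kn\}$, such that $|c(u)-c(v)|\ge d$ for every edge $(u,v)\in E$. In particular, a $(2,n)$-differential coloring is a bijection $c:V\to\{1,\dots,n\}$ with $|c(u)-c(v)|\ge 2$ for every edge $(u,v)$. A complete bipartite graph is a graph $K_{a,b}$ with both parts nonempty ($a,b\ge 1$), in which every vertex of one part is adjacent to every vertex of the other part and there are no other edges. -}

module Defs where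

open import Data.Bool using (Bool; true; false)
open import Data.Fin using (Fin)
open import Data.Nat using (ℕ; _≤_; ∣_-_∣)
open import Data.Product using (∃-syntax; _×_)
open import Function.Bundles using (_↔_; _⇔_)
open import Function.Definitions using (Injective)
open import Relation.Binary.Core using (Rel)
open import Relation.Binary.Definitions using (Decidable; Irreflexive; Symmetric)
open import Relation.Binary.PropositionalEquality using (_≡_; _≢_)
open import Level using (0ℓ)

-- The edge set of a finite graph is itself finite, hence the decidability
-- of adjacency.
record Graph (n : ℕ) : Set₁ where
  field
    V     : Set
    V↔Fin : V ↔ Fin n
    Adj   : Rel V 0ℓ
    adj?  : Decidable Adj
    irrefl : Irreflexive _≡_ Adj
    symm  : Symmetric Adj

module _ {n : ℕ} (G : Graph n) where
  open Graph G

  -- A map V → Bool encodes an ordered partition of V into two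
  -- (possibly empty) parts.
  IsBipartition : (V → Bool) → Set
  IsBipartition side = ∀ u v → Adj u v → side u ≢ side v

  Bipartite : Set
  Bipartite = ∃[ side ] IsBipartition side

  record IsCompleteBipartition (side : V → Bool) : Set where
    field
      left-nonempty  : ∃[ v ] side v ≡ false
      right-nonempty : ∃[ v ] side v ≡ true
      adj⇔opposite   : ∀ u v → Adj u v ⇔ side u ≢ side v

  CompleteBipartite : Set
  CompleteBipartite = ∃[ side ] IsCompleteBipartition side

  -- Colors are drawn from {1, …, m}; a (d,kn)-differential coloring is
  -- the case m = k * n.
  record IsDifferentialColoring (d m : ℕ) (c : V → ℕ) : Set where
    field
      color-range : ∀ v → 1 ≤ c v × c v ≤ m
      injective   : Injective _≡_ _≡_ c
      separated   : ∀ u v → Adj u v → d ≤ ∣ c u - c v ∣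

  HasDifferentialColoring : (d m : ℕ) → Set
  HasDifferentialColoring d m = ∃[ c ] IsDifferentialColoring d m c

{-# OPTIONS --safe #-}

-- A (2,n)-differential coloring lists the vertices so that consecutive ones are
-- never adjacent. In a complete bipartite graph nonadjacent vertices lie in the
-- same part, so such a list would stay in one part forever. Conversely, let L, R
-- be a bipartition. If every u ∈ L is adjacent to every v ∈ R, then, G not being
-- complete bipartite, there are no edges and any list works. Otherwise take a
-- nonadjacent pair u ∈ L, v ∈ R and list L ∖ {u}, u, v, R ∖ {v} in this order.
module Submission where

open import Data.Bool using (Bool; true; false; if_then_else_)
import Data.Bool.Properties as Bool
open import Data.Fin using (Fin; zero; suc; toℕ; fromℕ<; inject₁; combine; punchOut; _<_; _≤?_; _≟_)
open import Data.Fin.Induction using (<-weakInduction)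
open import Data.Fin.Patterns using (0F; 1F; 2F; 3F)
open import Data.Fin.Properties
  using (any?; injective⇒≤; punchOut-injective; toℕ-fromℕ<; toℕ-inject₁;
         combine-monoˡ-<; combine-injectiveʳ; <-cmp; ¬Fin0)
open import Data.Fin.Subset using (Subset; _∈_; ∣_∣)
open import Data.Fin.Subset.Properties using (p⊂q⇒∣p∣<∣q∣; ∣p∣≤n; ∣⊥∣≡0; ∉⊥; ⊥⊆)
open import Data.Nat as ℕ using (ℕ; zero; suc; z≤n; s≤s; z<s; s<s; ∣_-_∣; _*_)
import Data.Nat.Properties as ℕ
open import Data.Product using (∃; ∃-syntax; _×_; _,_; proj₁; proj₂)
open import Data.Vec using (tabulate)
open import Data.Vec.Properties using ([]=⇒lookup; lookup⇒[]=; lookup∘tabulate)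
open import Function using (_∘_)
open import Function.Bundles using (_⇔_; mk⇔; module Inverse; module Equivalence)
open import Function.Definitions using (Injective)
open import Relation.Binary.Definitions using (tri<; tri≈; tri>)
open import Relation.Binary.PropositionalEquality
  using (_≡_; _≢_; refl; sym; trans; cong; subst; subst₂)
open import Relation.Nullary using (¬_; Dec; yes; no; does; contradiction)
open import Relation.Nullary.Decidable using (dec-true; decidable-stable; _×-dec_; ¬?; map′)
open import Relation.Unary using (Pred; Decidable)
open import Level using (0ℓ)
open import Defs

-- If `i` were missed, punching it out of every value would leave an injection from `Fin (suc n)`
-- into `Fin n`.
injective⇒surjective : ∀ {n} {f : Fin n → Fin n} → Injective _≡_ _≡_ f → ∀ i → ∃[ j ] f j ≡ i
injective⇒surjective {suc n} {f} inj i with any? (λ j → f j ≟ i)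
... | yes hit = hit
... | no miss = contradiction (injective⇒≤ λ {j} {k} → inj ∘ punchOut-injective (avoids j) (avoids k)) ℕ.1+n≰n
  where
  avoids : ∀ j → i ≢ f j
  avoids j i≡fj = miss (j , sym i≡fj)

module _ {n : ℕ} {P : Pred (Fin n) 0ℓ} (P? : Decidable P) where

  ⟦_⟧ : Subset n
  ⟦_⟧ = tabulate (does ∘ P?)

  ∈⟦⟧⁺ : ∀ {x} → P x → x ∈ ⟦_⟧
  ∈⟦⟧⁺ {x} px = lookup⇒[]= x _ (trans (lookup∘tabulate _ x) (dec-true (P? x) px))

  ∈⟦⟧⁻ : ∀ {x} → x ∈ ⟦_⟧ → P x
  ∈⟦⟧⁻ {x} x∈ with P? x | trans (sym (lookup∘tabulate (does ∘ P?) x)) ([]=⇒lookup x∈)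
  ... | yes px | _  = px
  ... | no _   | ()

-- For an injective `key`, `rank` is the position, counted from 1, in the list sorted by `key`. A
-- list of the vertices can thus be given by keys with gaps between their values.
module Rank {n m : ℕ} (key : Fin n → Fin m) where

  below : Fin n → Subset n
  below x = ⟦ (λ y → key y ≤? key x) ⟧

  rank : Fin n → ℕ
  rank x = ∣ below x ∣

  self∈below : ∀ x → x ∈ below x
  self∈below x = ∈⟦⟧⁺ (λ y → key y ≤? key x) ℕ.≤-refl

  -- The inclusion of `below x` in `below y` is proper because `y` itself lies only in the latter.
  rank-mono-< : ∀ {x y} → key x < key y → rank x ℕ.< rank y
  rank-mono-< {x} {y} x<y = p⊂q⇒∣p∣<∣q∣
    ( (λ z∈ → ∈⟦⟧⁺ (λ z → key z ≤? key y)
        (ℕ.≤-trans (∈⟦⟧⁻ (λ z → key z ≤? key x) z∈) (ℕ.<⇒≤ x<y)))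
    , y , self∈below y
    , λ y∈ → ℕ.<⇒≱ x<y (∈⟦⟧⁻ (λ z → key z ≤? key x) y∈))

  rank-positive : ∀ x → 1 ℕ.≤ rank x
  rank-positive x = subst (ℕ._< rank x) (∣⊥∣≡0 n) (p⊂q⇒∣p∣<∣q∣ (⊥⊆ , x , self∈below x , ∉⊥))

  rank-injective : Injective _≡_ _≡_ key → Injective _≡_ _≡_ rank
  rank-injective key-inj {x} {y} eq with <-cmp (key x) (key y)
  ... | tri< x<y _ _ = contradiction eq (ℕ.<⇒≢ (rank-mono-< x<y))
  ... | tri≈ _ x≡y _ = key-inj x≡y
  ... | tri> _ _ y<x = contradiction (sym eq) (ℕ.<⇒≢ (rank-mono-< y<x))

between⇒2≤∣-∣ : ∀ {a b c} → a ℕ.< b → b ℕ.< c → 2 ℕ.≤ ∣ a - c ∣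
between⇒2≤∣-∣ {zero}  (s≤s _)   (s≤s b≤c) = ℕ.≤-trans (s≤s (s≤s z≤n)) (s≤s b≤c)
between⇒2≤∣-∣ {suc a} (s≤s a<b) (s≤s b<c) = between⇒2≤∣-∣ a<b b<c

∣n-1+n∣≡1 : ∀ n → ∣ n - suc n ∣ ≡ 1
∣n-1+n∣≡1 zero    = refl
∣n-1+n∣≡1 (suc n) = ∣n-1+n∣≡1 n

module _ {n : ℕ} (G : Graph n) where
  open Graph G
  open Inverse V↔Fin using (to; from; strictlyInverseˡ; strictlyInverseʳ)

  from-injective : Injective _≡_ _≡_ from
  from-injective eq = trans (sym (strictlyInverseˡ _)) (trans (cong to eq) (strictlyInverseˡ _))

  ∃V? : {P : Pred V 0ℓ} → Decidable P → Dec (∃ P)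
  ∃V? {P} P? = map′ (λ (i , p) → from i , p)
                    (λ (v , p) → to v , subst P (sym (strictlyInverseʳ v)) p)
                    (any? (P? ∘ from))

  to-injective : Injective _≡_ _≡_ to
  to-injective eq = trans (sym (strictlyInverseʳ _)) (trans (cong from eq) (strictlyInverseʳ _))

  -- Only injectivity is given, but there are as many colors as vertices, so every color is attained
  -- and the vertices can be listed by color. Colors start at 1 and `Fin n` at 0, hence the
  -- predecessor in `index`.
  module Enumeration {d c} (col : IsDifferentialColoring G d n c) where
    open IsDifferentialColoring col

    pred-color<n : ∀ v → ℕ.pred (c v) ℕ.< n
    pred-color<n v with c v | color-range v
    ... | suc _ | _ , c≤n = c≤n

    index : V → Fin n
    index v = fromℕ< (pred-color<n v)

    suc-index : ∀ v → suc (toℕ (index v)) ≡ c v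
    suc-index v = trans (cong suc (toℕ-fromℕ< (pred-color<n v)))
                        (ℕ.suc-pred (c v) {{ℕ.>-nonZero (proj₁ (color-range v))}})

    index-injective : Injective _≡_ _≡_ index
    index-injective eq = injective (trans (sym (suc-index _)) (trans (cong (suc ∘ toℕ) eq) (suc-index _)))

    index∘from-surjective : ∀ i → ∃[ j ] index (from j) ≡ i
    index∘from-surjective = injective⇒surjective (from-injective ∘ index-injective)

    vertex : Fin n → V
    vertex = from ∘ proj₁ ∘ index∘from-surjective

    index-vertex : ∀ i → index (vertex i) ≡ i
    index-vertex = proj₂ ∘ index∘from-surjective

    vertex-index : ∀ v → vertex (index v) ≡ v
    vertex-index v = index-injective (index-vertex (index v))

    color-vertex : ∀ i → c (vertex i) ≡ suc (toℕ i)
    color-vertex i = trans (sym (suc-index (vertex i))) (cong (suc ∘ toℕ) (index-vertex i))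

  -- One element ranked strictly between the two ends of an edge already forces distance 2. By
  -- symmetry it is enough to treat edges from the `false` side to the `true` side.
  rank-coloring : ∀ {m side} {key : Fin n → Fin m} → IsBipartition G side → Injective _≡_ _≡_ key →
    (∀ u v → Adj u v → side u ≡ false → side v ≡ true →
      ∃[ z ] key (to u) < key z × key z < key (to v)) →
    IsDifferentialColoring G 2 n (Rank.rank key ∘ to)
  rank-coloring {side = side} {key} bip key-inj gap = record
    { color-range = λ v → rank-positive (to v) , ∣p∣≤n (below (to v))
    ; injective   = to-injective ∘ rank-injective key-inj
    ; separated   = separated
    }
    where
    open Rank key

    separated-oriented : ∀ u v → Adj u v → side u ≡ false → side v ≡ true →
                         2 ℕ.≤ ∣ rank (to u) - rank (to v) ∣
    separated-oriented u v uv su sv =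
      let (_ , u<z , z<v) = gap u v uv su sv
      in between⇒2≤∣-∣ (rank-mono-< u<z) (rank-mono-< z<v)

    separated : ∀ u v → Adj u v → 2 ℕ.≤ ∣ rank (to u) - rank (to v) ∣
    separated u v uv with side u in su | side v in sv
    ... | false | true  = separated-oriented u v uv su sv
    ... | true  | false = subst (2 ℕ.≤_) (ℕ.∣-∣-comm (rank (to v)) _)
                            (separated-oriented v u (symm uv) sv su)
    ... | false | false = contradiction (trans su (sym sv)) (bip u v uv)
    ... | true  | true  = contradiction (trans su (sym sv)) (bip u v uv)

  module _ {side : V → Bool} {u v : V} (su : side u ≡ false) (sv : side v ≡ true) (¬uv : ¬ Adj u v) where

    -- The four values are the segments L ∖ {u}, u, v, R ∖ {v} of the list. Vertices are compared
    -- through `to`, since equality is decidable on `Fin n`.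
    block : V → Fin 4
    block w = if side w
      then (if does (to w ≟ to v) then 2F else 3F)
      else (if does (to w ≟ to u) then 1F else 0F)

    -- Lexicographic: the block first, then the index within it.
    blockKey : Fin n → Fin (4 * n)
    blockKey i = combine (block (from i)) i

    blockKey-injective : Injective _≡_ _≡_ blockKey
    blockKey-injective {i} {j} = combine-injectiveʳ (block (from i)) i (block (from j)) j

    blockKey-mono : ∀ {w z} → block w < block z → blockKey (to w) < blockKey (to z)
    blockKey-mono {w} {z} w<z = combine-monoˡ-< (to w) (to z)
      (subst₂ (λ a b → block a < block b) (sym (strictlyInverseʳ w)) (sym (strictlyInverseʳ z)) w<z)

    block-u : block u ≡ 1F
    block-u rewrite su | dec-true (to u ≟ to u) refl = refl

    block-v : block v ≡ 2F
    block-v rewrite sv | dec-true (to v ≟ to v) refl = refl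

    via : ∀ z {b p q : Fin 4} → block z ≡ b → p < b → b < q → ∃[ z ] p < block z × block z < q
    via z refl p<z z<q = z , p<z , z<q

    -- If `w` is not `u`, it lies in block 0 and `u` separates it from `w′`. If `w` is `u`, then
    -- `w′` is not `v`, as `u` and `v` are nonadjacent, so `w′` lies in block 3 and `v` separates
    -- them.
    block-between : ∀ w w′ → Adj w w′ → side w ≡ false → side w′ ≡ true →
                    ∃[ z ] block w < block z × block z < block w′
    block-between w w′ ww′ sw sw′ rewrite sw | sw′ with to w ≟ to u | to w′ ≟ to v
    ... | yes w≡u | yes w′≡v = contradiction (subst₂ Adj (to-injective w≡u) (to-injective w′≡v) ww′) ¬uv
    ... | yes _   | no _     = via v block-v (s<s z<s) (s<s (s<s z<s))
    ... | no _    | yes _    = via u block-u z<s (s<s z<s)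
    ... | no _    | no _     = via u block-u z<s (s<s z<s)

    nonadjacent-pair⇒colorable : IsBipartition G side → HasDifferentialColoring G 2 n
    nonadjacent-pair⇒colorable bip = _ , rank-coloring bip blockKey-injective λ w w′ ww′ sw sw′ →
      let (z , w<z , z<w′) = block-between w w′ ww′ sw sw′
      in to z , blockKey-mono w<z , blockKey-mono z<w′

  ¬complete⇒colorable : Bipartite G → ¬ CompleteBipartite G → HasDifferentialColoring G 2 n
  ¬complete⇒colorable (side , bip) ¬complete
    with ∃V? (λ u → ∃V? (λ v → side u Bool.≟ false ×-dec side v Bool.≟ true ×-dec ¬? (adj? u v)))
  ... | yes (u , v , su , sv , ¬uv) = nonadjacent-pair⇒colorable su sv ¬uv bip
  -- Any order works, as there are no edges to separate: the ends of an edge would witness that both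
  -- parts are nonempty, and without a nonadjacent opposite pair the graph would be complete
  -- bipartite.
  ... | no ¬pair = _ , rank-coloring {key = λ i → i} bip (λ eq → eq) λ u v uv su sv →
        contradiction (side , record
          { left-nonempty  = u , su
          ; right-nonempty = v , sv
          ; adj⇔opposite   = λ w w′ → mk⇔ (bip w w′) (opposite⇒adj w w′)
          }) ¬complete
    where
    opposite⇒adj-oriented : ∀ w w′ → side w ≡ false → side w′ ≡ true → Adj w w′
    opposite⇒adj-oriented w w′ sw sw′ =
      decidable-stable (adj? w w′) λ ¬ww′ → ¬pair (w , w′ , sw , sw′ , ¬ww′)

    opposite⇒adj : ∀ w w′ → side w ≢ side w′ → Adj w w′
    opposite⇒adj w w′ w≢w′ with side w in sw | side w′ in sw′
    ... | false | true  = opposite⇒adj-oriented w w′ sw sw′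
    ... | true  | false = symm (opposite⇒adj-oriented w′ w sw′ sw)
    ... | false | false = contradiction refl w≢w′
    ... | true  | true  = contradiction refl w≢w′

colorable⇒monochromatic : ∀ {n} (G : Graph n) {side : Graph.V G → Bool} →
  IsCompleteBipartition G side → HasDifferentialColoring G 2 n → ∀ u v → side u ≡ side v
-- Without vertices there is no first vertex to compare sides with.
colorable⇒monochromatic {zero} G _ _ u _ = contradiction (Inverse.to (Graph.V↔Fin G) u) ¬Fin0
colorable⇒monochromatic {suc n} G {side} complete (c , col) u v = trans (side-first u) (sym (side-first v))
  where
  open Graph G
  open IsCompleteBipartition complete
  open IsDifferentialColoring col
  open Enumeration G col

  distance-1 : ∀ i → ∣ c (vertex (inject₁ i)) - c (vertex (suc i)) ∣ ≡ 1
  distance-1 i rewrite color-vertex (inject₁ i) | color-vertex (suc i) | toℕ-inject₁ i = ∣n-1+n∣≡1 (toℕ i)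

  consecutive : ∀ i → side (vertex (inject₁ i)) ≡ side (vertex (suc i))
  consecutive i = decidable-stable (_ Bool.≟ _) λ opposite →
    -- Opposite sides would mean adjacency, hence colors at distance at least 2, that is, more than
    -- 1; but these two colors are successive.
    ℕ.<⇒≢ (separated _ _ (Equivalence.from (adj⇔opposite _ _) opposite)) (sym (distance-1 i))

  side-vertex : ∀ i → side (vertex i) ≡ side (vertex zero)
  side-vertex = <-weakInduction _ refl λ i eq → trans (sym (consecutive i)) eq

  side-first : ∀ w → side w ≡ side (vertex zero)
  -- Every vertex occurs in the list, so constancy along the list covers all of `V`.
  side-first w = trans (cong side (sym (vertex-index w))) (side-vertex (index w))

theorem1 : ∀ (n : ℕ) (G : Graph n) → Bipartite G →
    HasDifferentialColoring G 2 n ⇔ (¬ CompleteBipartite G)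
theorem1 n G bip = mk⇔ colorable⇒¬complete (¬complete⇒colorable G bip)
  where
  colorable⇒¬complete : HasDifferentialColoring G 2 n → ¬ CompleteBipartite G
  colorable⇒¬complete colorable (side , complete) =
    let (u , su) = IsCompleteBipartition.left-nonempty complete
        (v , sv) = IsCompleteBipartition.right-nonempty complete
    in contradiction (trans (sym su) (trans (colorable⇒monochromatic G complete colorable u v) sv)) λ ()
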